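{- Let $\mathcal{A}$ be a partial combinatory algebra, $S$ a set, and $\gamma\colon\mathcal{A}\to S$ a precomplete generalized numbering. Then there exists a total element $f\in\mathcal{A}$ such that for all $g\in\mathcal{A}$, if $g(fg)$ is defined then $g(fg)\sim_\gamma fg$.
   Context: A partial applicative structure (pas) is a set $\mathcal{A}$ together with a partial map $\mathcal{A}\times\mathcal{A}\to\mathcal{A}$, written $(a,b)\mapsto ab$ and called application; application associates to the left, so $abc$ means $(ab)c$. Write $t\downarrow$ if $t$ is defined. Terms over $\mathcal{A}$ are built from elements of $\mathcal{A}$, variables, and application; $t(a_1,\ldots,a_n)$ denotes the result of substituting $a_i\in\mathcal{A}$ for the variables $x_i$. Application is strict: for closed terms, $t_1t_2\downarrow$ requires $t_1\downarrow$ and $t_2\downarrow$. For closed terms, $t\simeq s$ means that either both are undefined, or both are defined and equal. An element $f\in\mathcal{A}$ is total if $fa\downarrow$ for every $a\in\mathcal{A}$. A pas $\mathcal{A}$ is a partial combinatory algebra (pca) if it is combinatory complete: for every $n\geq 0$ and every term $t(x_1,\ldots,x_n,x)$ with free variables among $x_1,\ldots,x_n,x$ there exists $b\in\mathcal{A}$ such that for all $a_1,\ldots,a_n,a\in\mathcal{A}$: (i) $ba_1\cdots a_n\downarrow$, and (ii) $ba_1\cdots a_na\simeq t(a_1,\ldots,a_n,a)$. A generalized numbering is a surjection $\gamma\colon\mathcal{A}\to S$, where $\mathcal{A}$ is a pca and $S$ is a set; write $a\sim_\gamma b$ if $\gamma(a)=\gamma(b)$. It is precomplete if for every term $t(x)$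 over $\mathcal{A}$ with one variable $x$ there exists a total element $f\in\mathcal{A}$ such that for every $a\in\mathcal{A}$: if $t(a)\downarrow$ then $fa\sim_\gamma t(a)$. -}

module Defs where

open import Data.Fin using (Fin)
open import Data.Nat using (ℕ; suc)
open import Data.Product using (_×_; ∃; ∃-syntax; ∃₂)
open import Data.Vec using (Vec; lookup; map; foldl; []; _∷_; _∷ʳ_)
open import Function.Bundles using (_↠_; _⇔_; module Surjection)
open import Level using (Level; _⊔_) renaming (suc to lsuc)
open import Relation.Binary.PropositionalEquality using (_≡_)

infixl 9 _·_

data Term {c} (A : Set c) (n : ℕ) : Set c where
  con : A → Term A n
  var : Fin n → Term A n
  _·_ : Term A n → Term A n → Term A n

ClosedTerm : ∀ {c} → Set c → Set c
ClosedTerm A = Term A 0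

_[_] : ∀ {c} {A : Set c} {n} → Term A n → Vec A n → ClosedTerm A
con a   [ as ] = con a
var i   [ as ] = con (lookup as i)
(t · s) [ as ] = (t [ as ]) · (s [ as ])

-- The closed term b a₁ ⋯ aₙ, associated to the left.
applyAll : ∀ {c} {A : Set c} {n} → A → Vec A n → ClosedTerm A
applyAll {A = A} b as = foldl (λ _ → ClosedTerm A) _·_ (con b) (map con as)

-- The partial application map is given by its graph: App a b d says that
-- ab is defined with value d.  Definedness is not assumed decidable.
record PAS c ℓ : Set (lsuc (c ⊔ ℓ)) where
  field
    Carrier    : Set c
    App        : Carrier → Carrier → Carrier → Set ℓ
    functional : ∀ {a b d e} → App a b d → App a b e → d ≡ e

  infix 4 _⇓_ _↓ _≃_

  -- A compound term has a value only if both of its subterms do, so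
  -- application is strict.
  data _⇓_ : ClosedTerm Carrier → Carrier → Set (c ⊔ ℓ) where
    con : ∀ {a} → con a ⇓ a
    app : ∀ {t s a b d} → t ⇓ a → s ⇓ b → App a b d → t · s ⇓ d

  _↓ : ClosedTerm Carrier → Set (c ⊔ ℓ)
  t ↓ = ∃[ a ] t ⇓ a

  -- Kleene equality.  Values being unique, this says that if either side is
  -- defined then both are, with equal values.  The literal disjunction "both
  -- undefined, or both defined and equal" agrees with it classically, but
  -- constructively would also decide definedness.
  _≃_ : ClosedTerm Carrier → ClosedTerm Carrier → Set (c ⊔ ℓ)
  t ≃ s = ∀ d → t ⇓ d ⇔ s ⇓ d

  Total : Carrier → Set (c ⊔ ℓ)
  Total f = ∀ a → con f · con a ↓

  CombinatoryComplete : Set (c ⊔ ℓ)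
  CombinatoryComplete =
    ∀ n (t : Term Carrier (suc n)) →
    ∃[ b ] ∀ (as : Vec Carrier n) a →
      (applyAll b as ↓) × (applyAll b as · con a ≃ t [ as ∷ʳ a ])

record PCA c ℓ : Set (lsuc (c ⊔ ℓ)) where
  field
    pas                 : PAS c ℓ
  open PAS pas public
  field
    combinatoryComplete : CombinatoryComplete

GeneralizedNumbering : ∀ {c ℓ s} → PCA c ℓ → Set s → Set (c ⊔ s)
GeneralizedNumbering 𝒜 S = PCA.Carrier 𝒜 ↠ S

module Numbering {c ℓ s} (𝒜 : PCA c ℓ) {S : Set s} (γ : GeneralizedNumbering 𝒜 S) where
  open PCA 𝒜

  infix 4 _∼_

  -- The relation ∼_γ between closed terms: both are defined, and γ identifies
  -- their values.
  _∼_ : ClosedTerm Carrier → ClosedTerm Carrier → Set (c ⊔ ℓ ⊔ s)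
  t ∼ u = ∃₂ λ a b → t ⇓ a × u ⇓ b × Surjection.to γ a ≡ Surjection.to γ b

  Precomplete : Set (c ⊔ ℓ ⊔ s)
  Precomplete =
    ∀ (t : Term Carrier 1) →
    ∃[ f ] Total f × (∀ a → t [ a ∷ [] ] ↓ → con f · con a ∼ t [ a ∷ [] ])

{-# OPTIONS --safe #-}
-- Precompleteness gives a total d with d a ∼ a a whenever a a is defined.  Let
-- b g a ≃ g (d a) and f g ≃ d (b g).  Then, if g (f g) is defined,
-- f g = d (b g) ∼ b g (b g) = g (d (b g)) = g (f g).
module Submission where

open import Data.Fin using (zero; suc)
open import Data.Product using (_×_; _,_; proj₁; proj₂; ∃-syntax)
open import Data.Vec using ([]; _∷_)
open import Function.Bundles using (module Equivalence)
open import Relation.Binary.PropositionalEquality using (refl; sym)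
open import Defs

theorem6p5 : ∀ {c ℓ s} (𝒜 : PCA c ℓ) (S : Set s) (γ : GeneralizedNumbering 𝒜 S) →
    let open PCA 𝒜
        open Numbering 𝒜 γ
    in Precomplete →
       ∃[ f ] Total f × (∀ g → con g · (con f · con g) ↓ → con g · (con f · con g) ∼ con f · con g)
theorem6p5 𝒜 S γ precomplete
  with precomplete (var zero · var zero)
... | d , d-total , d-diagonal
  with PCA.combinatoryComplete 𝒜 1 (var zero · (con d · var (suc zero)))
... | b , b-spec
  with PCA.combinatoryComplete 𝒜 0 (con d · (con b · var zero))
... | f , f-spec = f , f-total , f-fixed
  where
  open PCA 𝒜
  open Numbering 𝒜 γ

  -- Clause (i) of combinatory completeness makes `b` applied to `g` defined even where `g (f g)` is
  -- not. The last argument of `b-spec` is a mere filler here.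
  f-total : Total f
  f-total g with proj₁ (b-spec (g ∷ []) g)
  ... | p , bg⇓p with d-total p
  ... | v , app con con dp = v , Equivalence.from (proj₂ (f-spec [] g) v) (app con bg⇓p dp)

  f-fixed : ∀ g → con g · (con f · con g) ↓ → con g · (con f · con g) ∼ con f · con g
  f-fixed g (w , gfg⇓w@(app con fg⇓v gv))
    with Equivalence.to (proj₂ (f-spec [] g) _) fg⇓v
  ... | app {b = p} con (app con con bg) dp
    -- `p` is the value of `b g`; taking it as last argument too turns `g (d p) = w` into `p p = w`,
    -- the definedness that `d-diagonal` needs.
    with Equivalence.from (proj₂ (b-spec (g ∷ []) p) w) (app con (app con con dp) gv)
  ... | app (app con con bg′) con pp
    with functional bg bg′
  ... | refl
    with d-diagonal p (w , app con con pp)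
  ... | _ , _ , app con con dp′ , app con con pp′ , eq
    -- Uniqueness identifies the values that `eq` compares with those of `f g` and `g (f g)`.
    with functional dp dp′ | functional pp pp′
  ... | refl | refl = w , _ , gfg⇓w , fg⇓v , sym eq
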